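{- Let $G$ be an abelian group and $\precsim$ a total quasi-order on $G$. Then $\precsim$ is compatible with $+$ if and only if $G$ admits a subgroup $H$ satisfying: (1) $H$ is an initial segment of $(G,\precsim)$; (2) the restriction of $\precsim$ to $H$ makes $H$ an ordered abelian group; (3$'$) the relation on $G/H$ given by $g+H\precsim h+H\Leftrightarrow g-h\in H\vee(g-h\notin H\wedge g\precsim h)$ is well defined (independent of the choice of representatives) and is a quasi-order on $G/H$ induced by a valuation on $G/H$; (4) for all $g,h\in G$, if $g\notin H$ and $g-h\in H$ then $g\sim h$.
   Context: A quasi-order is a reflexive transitive relation; total means any two elements are comparable. $a\sim b$ means $a\precsim b\wedge b\precsim a$. $\precsim$ is compatible with $+$ if $(Q_1)$: $x\sim0\Rightarrow x=0$, and $(Q_2)$: $x\precsim y\wedge y\not\sim z\Rightarrow x+z\precsim y+z$, for all $x,y,z\in G$. An initial segment is a set $S$ with $s\in S$, $a\precsim s\Rightarrow a\in S$. An ordered abelian group is a group with a total order $\leq$ such that $x\leq y\Rightarrow x+z\leq y+z$. A valuation on an abelian group $A$ is a map $v:A\to\Gamma\cup\{\infty\}$ ($\Gamma$ totally ordered, $\infty$ above $\Gamma$) with $v(a)=\infty\Leftrightarrow a=0$, $v(a+b)\ge\min(v(a),v(b))$, $v(-a)=v(a)$; the quasi-order induced by $v$ is $a\precsim b\Leftrightarrow v(b)\le v(a)$. -}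

module Defs where

open import Algebra.Bundles using (AbelianGroup)
open import Algebra.Construct.NaturalChoice.Min as Min using ()
open import Algebra.Properties.AbelianGroup as AbelianGroupProperties using ()
open import Data.Product using (Σ; Σ-syntax; _×_; _,_; proj₁)
open import Data.Sum using (_⊎_)
open import Function.Base using (_on_)
open import Function.Bundles using (_⇔_)
open import Level using (Level; _⊔_; suc)
open import Relation.Binary.Bundles using (TotalOrder)
open import Relation.Binary.Construct.Add.Supremum.Equality as SupEquality using ()
open import Relation.Binary.Construct.Add.Supremum.NonStrict as SupNonStrict using ()
open import Relation.Binary.Core using (Rel)
open import Relation.Binary.Structures using (IsTotalOrder)
open import Relation.Nullary.Construct.Add.Supremum using (_⁺; ⊤⁺)
open import Relation.Nullary.Negation using (¬_)
open import Relation.Unary using (Pred)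

private
  variable
    a c d e ℓ r h : Level

Sim : {A : Set a} → Rel A r → Rel A r
Sim _≲_ x y = (x ≲ y) × (y ≲ x)

IsInitialSegment : {A : Set a} → Rel A r → Pred A h → Set (a ⊔ r ⊔ h)
IsInitialSegment _≲_ S = ∀ {s x} → S s → x ≲ s → S x

record IsCompatible (G : AbelianGroup c ℓ) (_≲_ : Rel (AbelianGroup.Carrier G) r)
                    : Set (c ⊔ ℓ ⊔ r) where
  open AbelianGroup G renaming (_∙_ to _+_; ε to 0#)
  field
    Q₁ : ∀ x → Sim _≲_ x 0# → x ≈ 0#
    Q₂ : ∀ x y z → x ≲ y → ¬ Sim _≲_ y z → (x + z) ≲ (y + z)

record IsOrderedAbelianGroup (G : AbelianGroup c ℓ) (_≤_ : Rel (AbelianGroup.Carrier G) r)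
                             : Set (c ⊔ ℓ ⊔ r) where
  open AbelianGroup G renaming (_∙_ to _+_)
  field
    isTotalOrder : IsTotalOrder _≈_ _≤_
    +-monoˡ-≤    : ∀ x y z → x ≤ y → (x + z) ≤ (y + z)

-- Γ ∪ {∞}, with ∞ = ⊤⁺ above Γ.
withTop : TotalOrder c d e → TotalOrder c (c ⊔ d) (c ⊔ e)
withTop Γ = record
  { Carrier      = Γ.Carrier ⁺
  ; _≈_          = SupEquality._≈⁺_ Γ._≈_
  ; _≤_          = SupNonStrict._≤⁺_ Γ._≤_
  ; isTotalOrder = SupNonStrict.≤⁺-isTotalOrder Γ._≤_ Γ.isTotalOrder
  }
  where module Γ = TotalOrder Γ

record IsValuation (A : AbelianGroup a ℓ) (Γ : TotalOrder c d e)
                   (v : AbelianGroup.Carrier A → TotalOrder.Carrier (withTop Γ))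
                   : Set (a ⊔ ℓ ⊔ c ⊔ d ⊔ e) where
  open AbelianGroup A renaming (_∙_ to _+_; ε to 0#; _⁻¹ to -_)
  open TotalOrder (withTop Γ) using (_≤_) renaming (_≈_ to _≈∞_)
  open Min (withTop Γ) using () renaming (_⊓_ to min)
  field
    v-cong : ∀ {x y} → x ≈ y → v x ≈∞ v y
    v≈∞⇔≈0 : ∀ x → (v x ≈∞ ⊤⁺) ⇔ (x ≈ 0#)
    v-+    : ∀ x y → min (v x) (v y) ≤ v (x + y)
    v-neg  : ∀ x → v (- x) ≈∞ v x

-- Γ is taken at level b, which the caller must choose large enough to
-- accommodate the value set of every valuation of interest (e.g. one whose
-- points are the nonzero elements of A).
IsInducedByValuation : (b : Level) (A : AbelianGroup a ℓ) → Rel (AbelianGroup.Carrier A) r →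
                       Set (a ⊔ ℓ ⊔ r ⊔ suc b)
IsInducedByValuation b A _≲_ =
  Σ[ Γ ∈ TotalOrder b b b ]
  Σ[ v ∈ (AbelianGroup.Carrier A → TotalOrder.Carrier (withTop Γ)) ]
    IsValuation A Γ v ×
    (∀ x y → (x ≲ y) ⇔ TotalOrder._≤_ (withTop Γ) (v y) (v x))

record IsSubgroup (G : AbelianGroup c ℓ) (H : Pred (AbelianGroup.Carrier G) h)
                  : Set (c ⊔ ℓ ⊔ h) where
  open AbelianGroup G renaming (_∙_ to _+_; ε to 0#; _⁻¹ to -_)
  field
    resp       : ∀ {x y} → x ≈ y → H x → H y
    0-mem      : H 0#
    +-closed   : ∀ {x y} → H x → H y → H (x + y)
    neg-closed : ∀ {x} → H x → H (- x)

module _ (G : AbelianGroup c ℓ) {H : Pred (AbelianGroup.Carrier G) h} (isSubgroup : IsSubgroup G H) where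

  open AbelianGroup G renaming (_∙_ to _+_; ε to 0#; _⁻¹ to -_)
  open AbelianGroupProperties G using (⁻¹-∙-comm; ⁻¹-anti-homo‿-)
  open IsSubgroup isSubgroup
  open import Relation.Binary.Reasoning.Setoid setoid

  subgroup : AbelianGroup (c ⊔ h) ℓ
  subgroup = record
    { Carrier        = Σ Carrier H
    ; _≈_            = _≈_ on proj₁
    ; _∙_            = λ (x , p) (y , q) → x + y , +-closed p q
    ; ε              = 0# , 0-mem
    ; _⁻¹            = λ (x , p) → - x , neg-closed p
    ; isAbelianGroup = record
      { isGroup = record
        { isMonoid = record
          { isSemigroup = record
            { isMagma = record
              { isEquivalence = record { refl = refl ; sym = sym ; trans = trans }
              ; ∙-cong = ∙-cong
              }
            ; assoc = λ (x , _) (y , _) (z , _) → assoc x y z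
            }
          ; identity = (λ (x , _) → identityˡ x) , (λ (x , _) → identityʳ x)
          }
        ; inverse = (λ (x , _) → inverseˡ x) , (λ (x , _) → inverseʳ x)
        ; ⁻¹-cong = ⁻¹-cong
        }
      ; comm = λ (x , _) (y , _) → comm x y
      }
    }

  private
    ≈⇒mem : ∀ {x y} → x ≈ y → H (x - y)
    ≈⇒mem {x} {y} x≈y = resp (sym (trans (∙-congʳ x≈y) (inverseʳ y))) 0-mem

    telescope : ∀ x y z → (x - y) + (y - z) ≈ x - z
    telescope x y z = begin
      (x - y) + (y - z)      ≈⟨ assoc x (- y) (y - z) ⟩
      x + (- y + (y - z))    ≈⟨ ∙-congˡ (assoc (- y) y (- z)) ⟨
      x + ((- y + y) + - z)  ≈⟨ ∙-congˡ (∙-congʳ (inverseˡ y)) ⟩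
      x + (0# + - z)         ≈⟨ ∙-congˡ (identityˡ (- z)) ⟩
      x - z                  ∎

    interchange : ∀ x y u v → (x - y) + (u - v) ≈ (x + u) - (y + v)
    interchange x y u v = begin
      (x - y) + (u - v)        ≈⟨ assoc x (- y) (u - v) ⟩
      x + (- y + (u - v))      ≈⟨ ∙-congˡ (assoc (- y) u (- v)) ⟨
      x + ((- y + u) + - v)    ≈⟨ ∙-congˡ (∙-congʳ (comm (- y) u)) ⟩
      x + ((u + - y) + - v)    ≈⟨ ∙-congˡ (assoc u (- y) (- v)) ⟩
      x + (u + (- y + - v))    ≈⟨ assoc x u (- y + - v) ⟨
      (x + u) + (- y + - v)    ≈⟨ ∙-congˡ (⁻¹-∙-comm y v) ⟩
      (x + u) - (y + v)        ∎

  -- G/H has the carrier of G (an element g stands for the coset g + H) and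
  -- equality of cosets, g - g′ ∈ H, as its setoid equality.
  quotient : AbelianGroup c h
  quotient = record
    { Carrier = Carrier
    ; _≈_     = λ g g′ → H (g - g′)
    ; _∙_     = _+_
    ; ε       = 0#
    ; _⁻¹     = -_
    ; isAbelianGroup = record
      { isGroup = record
        { isMonoid = record
          { isSemigroup = record
            { isMagma = record
              { isEquivalence = record
                { refl  = ≈⇒mem refl
                ; sym   = λ {x} {y} p → resp (⁻¹-anti-homo‿- x y) (neg-closed p)
                ; trans = λ {x} {y} {z} p q → resp (telescope x y z) (+-closed p q)
                }
              ; ∙-cong = λ {x} {y} {u} {v} p q → resp (interchange x y u v) (+-closed p q)
              }
            ; assoc = λ x y z → ≈⇒mem (assoc x y z)
            }
          ; identity = (λ x → ≈⇒mem (identityˡ x)) , (λ x → ≈⇒mem (identityʳ x))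
          }
        ; inverse = (λ x → ≈⇒mem (inverseˡ x)) , (λ x → ≈⇒mem (inverseʳ x))
        ; ⁻¹-cong = λ {x} {y} p → resp (sym (⁻¹-∙-comm x (- y))) (neg-closed p)
        }
      ; comm = λ x y → ≈⇒mem (comm x y)
      }
    }

restrict : {A : Set a} (H : Pred A h) → Rel A r → Rel (Σ A H) r
restrict H _≲_ = _≲_ on proj₁

-- The formula for g + H ≲ h + H in terms of the representatives g and h.
QuotientRel : (G : AbelianGroup c ℓ) → Pred (AbelianGroup.Carrier G) h →
              Rel (AbelianGroup.Carrier G) r → Rel (AbelianGroup.Carrier G) (h ⊔ r)
QuotientRel G H _≲_ x y = H (x - y) ⊎ (¬ H (x - y) × (x ≲ y))
  where open AbelianGroup G using (_-_)

{-# OPTIONS --safe #-}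

-- If ≲ is compatible, take H = {x : x ≲ 0 or -x ≲ 0}.  The elements a outside
-- H satisfy 0 < a ~ -a, while s ∈ H with s ~ -s forces s = 0.  If s ≁ -s and
-- a ∉ H, then a + s ≲ s would give a ≲ 0, so s < a + s; if moreover
-- a + s ≁ -a, then -a + s ≲ s, which is excluded in the same way.  Hence
-- s < a + s ~ a, so H is an initial segment whose cosets outside H are
-- ~-classes.  On G/H the value set is the set of nonzero cosets with the order
-- reversed; the ultrametric inequality y ≲ x ⇒ x + y ≲ x holds because x < w,
-- w = x + y, would give w ≲ x + w ~ x - w = -y ~ y ≲ x.
--
-- Conversely, (Q₂) is monotonicity in H for y, z ∈ H, holds by (4) for y ∈ H
-- and z ∉ H, and for y ∉ H follows because elements of different value
-- satisfy v(y + z) = min (v y) (v z).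

module Submission where

open import Defs
open import Algebra.Bundles using (AbelianGroup)
import Algebra.Construct.NaturalChoice.Min as Min
import Algebra.Properties.AbelianGroup as AbelianGroupProperties
open import Axiom.ExcludedMiddle using (ExcludedMiddle)
open import Data.Product using (Σ-syntax; _×_; _,_; proj₁; proj₂; swap)
open import Data.Sum using (_⊎_; inj₁; inj₂)
import Data.Sum as Sum
open import Function.Base using (_∘_)
open import Function.Bundles using (_⇔_; mk⇔; Equivalence)
open import Level using (Level; _⊔_; Lift; lift; lower)
open import Relation.Binary.Bundles using (TotalOrder)
import Relation.Binary.Construct.Add.Supremum.Equality as SupEquality
import Relation.Binary.Construct.Add.Supremum.NonStrict as SupNonStrict
open import Relation.Binary.Core using (Rel)
open import Relation.Binary.Definitions using (_Respects₂_)
open import Relation.Binary.Structures using (IsPreorder; IsTotalOrder; IsTotalPreorder)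
open import Relation.Nullary.Construct.Add.Supremum using (⊤⁺; [_])
open import Relation.Nullary.Decidable using (Dec; yes; no; map′)
open import Relation.Nullary.Negation using (¬_; contradiction)
open import Relation.Unary using (Pred)

private
  variable
    a b c ℓ r : Level

lower-em : ∀ b → ExcludedMiddle (b ⊔ r) → ExcludedMiddle r
lower-em b em {P} = map′ lower lift (em {Lift b P})

-- Quasi-orders induced by valuations

module _ (A : AbelianGroup a ℓ) (_≲_ : Rel (AbelianGroup.Carrier A) r) where

  open AbelianGroup A renaming (_∙_ to _+_; ε to 0#; _⁻¹ to -_) hiding (refl; sym; trans; reflexive)

  module _ (induced : IsInducedByValuation b A _≲_) where

    private
      v = proj₁ (proj₂ induced)
      open IsValuation (proj₁ (proj₂ (proj₂ induced)))
      open TotalOrder (withTop (proj₁ induced)) using () renaming (trans to ≤-trans; reflexive to ≤-reflexive; module Eq to ≈∞)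
      open Min (withTop (proj₁ induced)) using (⊓-glb)
      module ≲⇔ x y = Equivalence (proj₂ (proj₂ (proj₂ induced)) x y)

    induced-neg : ∀ x → (- x) ≲ x
    induced-neg x = ≲⇔.from (- x) x (≤-reflexive (≈∞.sym (v-neg x)))

    induced-+ : ∀ {x y z} → x ≲ z → y ≲ z → (x + y) ≲ z
    induced-+ {x} {y} {z} x≲z y≲z = ≲⇔.from (x + y) z
      (≤-trans (⊓-glb (≲⇔.to x z x≲z) (≲⇔.to y z y≲z)) (v-+ x y))

  module _ (isTotalPreorder : IsTotalPreorder _≈_ _≲_) (≟0 : ∀ x → Dec (x ≈ 0#))
           (≲0⇒≈0 : ∀ {x} → x ≲ 0# → x ≈ 0#)
           (neg-≲ : ∀ x → (- x) ≲ x)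
           (+-≲ : ∀ {x y} → y ≲ x → (x + y) ≲ x)
           where

    open IsTotalPreorder isTotalPreorder

    private
      -- Since `- x ≲ x`, the sum `x + - x` stays below `x`.
      0≲ : ∀ x → 0# ≲ x
      0≲ x = ≲-respˡ-≈ (inverseʳ x) (+-≲ (neg-≲ x))

      -- Equality of values is `~`, so no quotient has to be formed. The lifts only bring carrier,
      -- equality and order to one common level.
      Γ : TotalOrder (a ⊔ ℓ ⊔ r) (a ⊔ ℓ ⊔ r) (a ⊔ ℓ ⊔ r)
      Γ = record
        { Carrier      = Lift r (Σ[ x ∈ Carrier ] ¬ (x ≈ 0#))
        ; _≈_          = λ p q → Lift (a ⊔ ℓ) (Sim _≲_ (rep p) (rep q))
        ; _≤_          = λ p q → Lift (a ⊔ ℓ) (rep q ≲ rep p)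
        ; isTotalOrder = record
          { isPartialOrder = record
            { isPreorder = record
              { isEquivalence = record
                { refl  = lift (refl , refl)
                ; sym   = λ (lift p) → lift (swap p)
                ; trans = λ (lift (p , p′)) (lift (q , q′)) → lift (trans p q , trans q′ p′)
                }
              ; reflexive = λ (lift (_ , p)) → lift p
              ; trans     = λ (lift p) (lift q) → lift (trans q p)
              }
            ; antisym = λ (lift p) (lift q) → lift (q , p)
            }
          ; total = λ p q → Sum.map lift lift (total (rep q) (rep p))
          }
        }
        where
        rep : Lift r (Σ[ x ∈ Carrier ] ¬ (x ≈ 0#)) → Carrier
        rep (lift (x , _)) = x

      module Γ∞ = TotalOrder (withTop Γ)
      open Min (withTop Γ) using (x⊓y≤x; x⊓y≤y)

      -- The decision is a separate argument so that the lemmas below can match on it directly.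
      value : ∀ x → Dec (x ≈ 0#) → Γ∞.Carrier
      value x (yes _)  = ⊤⁺
      value x (no x≉0) = [ lift (x , x≉0) ]

      v : Carrier → Γ∞.Carrier
      v x = value x (≟0 x)

      value-antitone : ∀ {x y} dx dy → x ≲ y → value y dy Γ∞.≤ value x dx
      value-antitone (yes _)  _         _   = _ SupNonStrict.≤⊤⁺
      value-antitone (no x≉0) (yes y≈0) x≲y = contradiction (≲0⇒≈0 (≲-respʳ-≈ y≈0 x≲y)) x≉0
      value-antitone (no _)   (no _)    x≲y = SupNonStrict.[ lift x≲y ]

      value-reflects : ∀ {x y} dx dy → value y dy Γ∞.≤ value x dx → x ≲ y
      value-reflects (yes x≈0) _      _                        = ≲-respˡ-≈ (Eq.sym x≈0) (0≲ _)
      value-reflects (no _)    (no _) SupNonStrict.[ lift p ] = p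

      v-antitone : ∀ {x y} → x ≲ y → v y Γ∞.≤ v x
      v-antitone = value-antitone (≟0 _) (≟0 _)

      v-≈ : ∀ {x y} → x ≲ y → y ≲ x → v x Γ∞.≈ v y
      v-≈ x≲y y≲x = Γ∞.antisym (v-antitone y≲x) (v-antitone x≲y)

      value≈∞ : ∀ {x} dx → value x dx Γ∞.≈ ⊤⁺ → x ≈ 0#
      value≈∞ (yes x≈0) _ = x≈0

      ≈0⇒value≈∞ : ∀ {x} dx → x ≈ 0# → value x dx Γ∞.≈ ⊤⁺
      ≈0⇒value≈∞ (yes _)  _   = SupEquality.⊤⁺≈⊤⁺
      ≈0⇒value≈∞ (no x≉0) x≈0 = contradiction x≈0 x≉0

      min≤v+ : ∀ x y → Min._⊓_ (withTop Γ) (v x) (v y) Γ∞.≤ v (x + y)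
      min≤v+ x y with total y x
      ... | inj₁ y≲x = Γ∞.trans (x⊓y≤x (v x) (v y)) (v-antitone (+-≲ y≲x))
      ... | inj₂ x≲y = Γ∞.trans (x⊓y≤y (v x) (v y))
                         (v-antitone (≲-respˡ-≈ (comm y x) (+-≲ x≲y)))

    ultrametric⇒induced : IsInducedByValuation (a ⊔ ℓ ⊔ r) A _≲_
    ultrametric⇒induced = Γ , v , isValuation ,
      λ x y → mk⇔ v-antitone (value-reflects (≟0 x) (≟0 y))
      where
      x≲-x : ∀ x → x ≲ (- x)
      x≲-x x = ≲-respˡ-≈ (AbelianGroupProperties.⁻¹-involutive A x) (neg-≲ (- x))

      isValuation : IsValuation A Γ v
      isValuation = record
        { v-cong = λ x≈y → v-≈ (reflexive x≈y) (reflexive (Eq.sym x≈y))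
        ; v≈∞⇔≈0 = λ x → mk⇔ (value≈∞ (≟0 x)) (≈0⇒value≈∞ (≟0 x))
        ; v-+    = min≤v+
        ; v-neg  = λ x → v-≈ (neg-≲ x) (x≲-x x)
        }

module _ (G : AbelianGroup c ℓ) (_≲_ : Rel (AbelianGroup.Carrier G) r)
         (isTotalPreorder : IsTotalPreorder (AbelianGroup._≈_ G) _≲_)
         (em : ExcludedMiddle (c ⊔ ℓ ⊔ r))
         where

  open AbelianGroup G renaming (_∙_ to _+_; ε to 0#; _⁻¹ to -_)
  open AbelianGroupProperties G
  open IsTotalPreorder isTotalPreorder using (≲-respˡ-≈; ≲-respʳ-≈; total)
    renaming (refl to ≲-refl; trans to ≲-trans; reflexive to ≲-reflexive)

  private
    infix 4 _~_
    _~_ : Rel Carrier r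
    _~_ = Sim _≲_

    ~-trans : ∀ {x y z} → x ~ y → y ~ z → x ~ z
    ~-trans (p , p′) (q , q′) = ≲-trans p q , ≲-trans q′ p′

    ~-reflexive : ∀ {x y} → x ≈ y → x ~ y
    ~-reflexive x≈y = ≲-reflexive x≈y , ≲-reflexive (sym x≈y)

    ≴⇒≲ : ∀ {x y} → ¬ (y ≲ x) → x ≲ y
    ≴⇒≲ {x} {y} y≴x with total x y
    ... | inj₁ x≲y = x≲y
    ... | inj₂ y≲x = contradiction y≲x y≴x

    em-r : ExcludedMiddle r
    em-r = lower-em (c ⊔ ℓ) em

    _~?_ : ∀ x y → Dec (x ~ y)
    x ~? y = em-r

  -- The quotient relation for a subgroup whose cosets outside it lie in ~-classes

  module QuotientOrder {H : Pred Carrier (c ⊔ ℓ ⊔ r)} (isSubgroup : IsSubgroup G H)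
           (initial : IsInitialSegment _≲_ H)
           (coset-~ : ∀ g h → ¬ H g → H (g - h) → Sim _≲_ g h)
           where

    open IsSubgroup isSubgroup
    open AbelianGroup (quotient G isSubgroup) using ()
      renaming (_≈_ to _≈/_; isEquivalence to ≈/-isEquivalence)

    infix 4 _≲/_
    _≲/_ : Rel Carrier (c ⊔ ℓ ⊔ r)
    _≲/_ = QuotientRel G H _≲_

    mem⇒≈/ : ∀ {x y} → H x → H y → x ≈/ y
    mem⇒≈/ x∈H y∈H = +-closed x∈H (neg-closed y∈H)

    ≲⇒≲/ : ∀ {x y} → x ≲ y → x ≲/ y
    ≲⇒≲/ {x} {y} x≲y with em {H (x - y)}
    ... | yes x-y∈H = inj₁ x-y∈H
    ... | no  x-y∉H = inj₂ (x-y∉H , x≲y)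

    mem⇒≲/ : ∀ {x y} → H x → x ≲/ y
    mem⇒≲/ {x} {y} x∈H with em {H y}
    ... | yes y∈H = inj₁ (mem⇒≈/ x∈H y∈H)
    ... | no  y∉H = ≲⇒≲/ (≴⇒≲ (y∉H ∘ initial x∈H))

    -- Congruent elements outside `H` are `~` by `coset-~`, so `≲/` adds to `≲` only pairs whose
    -- left side lies in `H`.
    ≲/⇒mem⊎≲ : ∀ {x y} → x ≲/ y → H x ⊎ x ≲ y
    ≲/⇒mem⊎≲ (inj₂ (_ , x≲y)) = inj₂ x≲y
    ≲/⇒mem⊎≲ {x} {y} (inj₁ x≈/y) with em {H x}
    ... | yes x∈H = inj₁ x∈H
    ... | no  x∉H = inj₂ (proj₁ (coset-~ x y x∉H x≈/y))

    ≲/-mem : ∀ {x y} → x ≲/ y → H y → H x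
    ≲/-mem x≲/y y∈H with ≲/⇒mem⊎≲ x≲/y
    ... | inj₁ x∈H = x∈H
    ... | inj₂ x≲y = initial y∈H x≲y

    ≲/⇒≲ : ∀ {x y} → ¬ H y → x ≲/ y → x ≲ y
    ≲/⇒≲ y∉H x≲/y with ≲/⇒mem⊎≲ x≲/y
    ... | inj₁ x∈H = ≴⇒≲ (y∉H ∘ initial x∈H)
    ... | inj₂ x≲y = x≲y

    ≲/-trans : ∀ {x y z} → x ≲/ y → y ≲/ z → x ≲/ z
    ≲/-trans x≲/y y≲/z with ≲/⇒mem⊎≲ x≲/y | ≲/⇒mem⊎≲ y≲/z
    ... | inj₁ x∈H | _        = mem⇒≲/ x∈H
    ... | inj₂ _   | inj₁ y∈H = mem⇒≲/ (≲/-mem x≲/y y∈H)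
    ... | inj₂ x≲y | inj₂ y≲z = ≲⇒≲/ (≲-trans x≲y y≲z)

    -- Independence of representatives comes with this: a transitive relation containing `≈/`
    -- respects `≈/`.
    ≲/-isTotalPreorder : IsTotalPreorder _≈/_ _≲/_
    ≲/-isTotalPreorder = record
      { isPreorder = record
        { isEquivalence = ≈/-isEquivalence
        ; reflexive     = inj₁
        ; trans         = ≲/-trans
        }
      ; total = λ x y → Sum.map ≲⇒≲/ ≲⇒≲/ (total x y)
      }

  -- From compatibility to the subgroup.

  module FromCompatible (isCompatible : IsCompatible G _≲_) where

    open IsCompatible isCompatible

    private
      shift : ∀ {x y u w} z → x + z ≈ u → y + z ≈ w → x ≲ y → ¬ (y ~ z) → u ≲ w
      shift z x+z≈u y+z≈w x≲y y≁z = ≲-respˡ-≈ x+z≈u (≲-respʳ-≈ y+z≈w (Q₂ _ _ z x≲y y≁z))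

    data H (x : Carrier) : Set (c ⊔ ℓ ⊔ r) where
      nonpos : x ≲ 0# → H x
      nonneg : (- x) ≲ 0# → H x

    H-resp : ∀ {x y} → x ≈ y → H x → H y
    H-resp x≈y (nonpos p) = nonpos (≲-respˡ-≈ x≈y p)
    H-resp x≈y (nonneg p) = nonneg (≲-respˡ-≈ (⁻¹-cong x≈y) p)

    H-0 : H 0#
    H-0 = nonpos ≲-refl

    H-neg : ∀ {x} → H x → H (- x)
    H-neg {x} (nonpos p) = nonneg (≲-respˡ-≈ (sym (⁻¹-involutive x)) p)
    H-neg     (nonneg p) = nonpos p

    ∉H-neg : ∀ {x} → ¬ H x → ¬ H (- x)
    ∉H-neg {x} x∉H -x∈H = x∉H (H-resp (⁻¹-involutive x) (H-neg -x∈H))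

    -- `Q₂` allows adding `- x` to `x ≲ 0#` unless `0# ~ - x`, and that exception contains the
    -- claim.
    ≲0⇒0≲neg : ∀ {x} → x ≲ 0# → 0# ≲ (- x)
    ≲0⇒0≲neg {x} x≲0 with 0# ~? (- x)
    ... | yes (0≲-x , _) = 0≲-x
    ... | no 0≁-x        = shift (- x) (inverseʳ x) (identityˡ (- x)) x≲0 0≁-x

    -- Both ways of lying in `H` yield `x ≲ 0#` here, whence `0# ≲ - x ≲ x` and `Q₁` applies.
    H-~neg⇒≈0 : ∀ {x} → H x → x ~ - x → x ≈ 0#
    H-~neg⇒≈0 {x} x∈H (x≲-x , -x≲x) = Q₁ x (x≲0 x∈H , ≲-trans (≲0⇒0≲neg (x≲0 x∈H)) -x≲x)
      where
      x≲0 : H x → x ≲ 0#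
      x≲0 (nonpos p) = p
      x≲0 (nonneg p) = ≲-trans x≲-x p

    ∉H⇒0≲ : ∀ {x} → ¬ H x → 0# ≲ x
    ∉H⇒0≲ x∉H = ≴⇒≲ (x∉H ∘ nonpos)

    -- Otherwise `- x` could be added to `0# ≲ x`, giving `- x ≲ 0#` and so `x` in `H`.
    ∉H⇒~neg : ∀ {x} → ¬ H x → x ~ - x
    ∉H⇒~neg {x} x∉H with x ~? (- x)
    ... | yes p    = p
    ... | no  x≁-x = contradiction
      (nonneg (shift (- x) (identityˡ (- x)) (inverseʳ x) (∉H⇒0≲ x∉H) x≁-x)) x∉H

    ∉H-+-≴ : ∀ {x s} → ¬ H x → ¬ (s ~ - s) → ¬ ((x + s) ≲ s)
    ∉H-+-≴ {x} {s} x∉H s≁-s x+s≲s =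
      x∉H (nonpos (shift (- s) (//-rightDividesʳ s x) (inverseʳ s) x+s≲s s≁-s))

    ∉H-+-~ : ∀ {x s} → ¬ H x → ¬ (s ~ - s) → (x + s) ~ x
    ∉H-+-~ {x} {s} x∉H s≁-s with (x + s) ~? (- x)
    ... | yes x+s~-x = ~-trans x+s~-x (swap (∉H⇒~neg x∉H))
    ... | no  x+s≁-x = contradiction
      (shift (- x) (comm s (- x)) (xyx⁻¹≈y x s) (≴⇒≲ (∉H-+-≴ x∉H s≁-s)) x+s≁-x)
      (∉H-+-≴ (∉H-neg x∉H) s≁-s)

    H-absorbed : ∀ {x s} → ¬ H x → H s → (x + s) ~ x
    H-absorbed {x} {s} x∉H s∈H with s ~? (- s)
    ... | yes s~-s = ~-reflexive (trans (∙-congˡ (H-~neg⇒≈0 s∈H s~-s)) (identityʳ x))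
    ... | no  s≁-s = ∉H-+-~ x∉H s≁-s

    H-initial : IsInitialSegment _≲_ H
    H-initial {s} {x} s∈H x≲s with em {H x}
    ... | yes x∈H = x∈H
    ... | no  x∉H with s ~? (- s)
    ...   | yes s~-s = nonpos (≲-respʳ-≈ (H-~neg⇒≈0 s∈H s~-s) x≲s)
    ...   | no  s≁-s = contradiction (≲-trans (proj₁ (∉H-+-~ x∉H s≁-s)) x≲s) (∉H-+-≴ x∉H s≁-s)

    -- A sum outside `H` would absorb `- y` and thus be `~` to `(x + y) - y = x`, which lies in the
    -- initial segment `H`.
    H-+ : ∀ {x y} → H x → H y → H (x + y)
    H-+ {x} {y} x∈H y∈H with em {H (x + y)}
    ... | yes x+y∈H = x+y∈H
    ... | no  x+y∉H = H-initial x∈H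
      (≲-respʳ-≈ (//-rightDividesʳ y x) (proj₂ (H-absorbed x+y∉H (H-neg y∈H))))

    H-isSubgroup : IsSubgroup G H
    H-isSubgroup = record
      { resp = H-resp ; 0-mem = H-0 ; +-closed = H-+ ; neg-closed = H-neg }

    -- Subtracting `y` from both inequalities gives `x - y ~ 0#`. This is blocked only if `y ~ - y`,
    -- and then `y` is zero.
    H-antisym : ∀ {x y} → H y → x ~ y → x ≈ y
    H-antisym {x} {y} y∈H x~y@(x≲y , y≲x) with y ~? (- y)
    ... | yes y~-y = let y≈0 = H-~neg⇒≈0 y∈H y~-y in
      trans (Q₁ x (~-trans x~y (~-reflexive y≈0))) (sym y≈0)
    ... | no  y≁-y = x∙y⁻¹≈ε⇒x≈y x y (Q₁ (x - y)
      ( shift (- y) refl (inverseʳ y) x≲y y≁-y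
      , shift (- y) (inverseʳ y) refl y≲x (y≁-y ∘ ~-trans (swap x~y))))

    -- The only case of monotonicity in H not covered by Q₂.
    H-double-mono : ∀ {x y} → H x → H y → x ≲ y → (x + y) ≲ (y + y)
    H-double-mono {x} {y} x∈H y∈H x≲y with total (x + y) (y + y)
    ... | inj₁ x+y≲y+y = x+y≲y+y
    -- When `y` is nonzero, the reverse inequality forces `x ≈ y`: cancel `y` if `Q₂` permits it.
    ... | inj₂ y+y≲x+y with y ~? (- y)
    ...   | yes y~-y = let y≈0 = H-~neg⇒≈0 y∈H y~-y in
      ≲-respˡ-≈ (sym (trans (∙-congˡ y≈0) (identityʳ x)))
        (≲-respʳ-≈ (sym (trans (∙-congˡ y≈0) (identityʳ y))) x≲y)
    ...   | no  y≁-y with (x + y) ~? (- y)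
    ...     | no x+y≁-y = ≲-reflexive (∙-congʳ (H-antisym y∈H
      (x≲y , shift (- y) (//-rightDividesʳ y y) (//-rightDividesʳ y x) y+y≲x+y x+y≁-y)))
    -- Cancelling `y` is blocked, but now `x + y = - y`. So `y + y ≲ - y`, which gives `3y ≲ 0`, and
    -- `x - y = -3y` is at least zero; `x ≲ y` makes it at most zero.
    ...     | yes x+y~-y = ≲-reflexive (∙-congʳ (x∙y⁻¹≈ε⇒x≈y x y (Q₁ (x - y) (x-y≲0 , 0≲x-y))))
      where
      open import Relation.Binary.Reasoning.Setoid setoid

      x+y≈-y : x + y ≈ - y
      x+y≈-y = H-antisym (H-neg y∈H) x+y~-y

      3y≲0 : (y + y + y) ≲ 0#
      3y≲0 = shift y refl (inverseˡ y) (≲-respʳ-≈ x+y≈-y y+y≲x+y) (y≁-y ∘ swap)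

      x-y≈-3y : x - y ≈ - (y + y + y)
      x-y≈-3y = inverseˡ-unique (x - y) (y + y + y) (begin
        (x - y) + (y + y + y)    ≈⟨ assoc (x - y) (y + y) y ⟨
        (x - y) + (y + y) + y    ≈⟨ ∙-congʳ (assoc (x - y) y y) ⟨
        (x - y) + y + y + y      ≈⟨ ∙-congʳ (∙-congʳ (//-rightDividesˡ y x)) ⟩
        x + y + y                ≈⟨ ∙-congʳ x+y≈-y ⟩
        - y + y                  ≈⟨ inverseˡ y ⟩
        0#                       ∎)

      x-y≲0 : (x - y) ≲ 0#
      x-y≲0 = shift (- y) refl (inverseʳ y) x≲y y≁-y

      0≲x-y : 0# ≲ (x - y)
      0≲x-y = ≲-respʳ-≈ (sym x-y≈-3y) (≲0⇒0≲neg 3y≲0)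

    H-mono : ∀ {x y z} → H x → H y → x ≲ y → (x + z) ≲ (y + z)
    H-mono {x} {y} {z} x∈H y∈H x≲y with y ~? z
    ... | no  y≁z = Q₂ x y z x≲y y≁z
    ... | yes y~z = let z≈y = H-antisym y∈H (swap y~z) in
      ≲-respˡ-≈ (∙-congˡ (sym z≈y)) (≲-respʳ-≈ (∙-congˡ (sym z≈y)) (H-double-mono x∈H y∈H x≲y))

    H-isOrderedAbelianGroup :
      IsOrderedAbelianGroup (subgroup G H-isSubgroup) (restrict H _≲_)
    H-isOrderedAbelianGroup = record
      { isTotalOrder = record
        { isPartialOrder = record
          { isPreorder = record
            { isEquivalence = AbelianGroup.isEquivalence (subgroup G H-isSubgroup)
            ; reflexive     = ≲-reflexive
            ; trans         = ≲-trans
            }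
          ; antisym = λ {_} {(_ , y∈H)} x≲y y≲x → H-antisym y∈H (x≲y , y≲x)
          }
        ; total = λ (x , _) (y , _) → total x y
        }
      ; +-monoˡ-≤ = λ (_ , x∈H) (_ , y∈H) _ → H-mono x∈H y∈H
      }

    H-coset-~ : ∀ x y → ¬ H x → H (x - y) → x ~ y
    H-coset-~ x y x∉H x-y∈H = swap (~-trans (~-reflexive y≈) (H-absorbed x∉H (H-neg x-y∈H)))
      where
      y≈ : y ≈ x - (x - y)
      y≈ = sym (trans (∙-congˡ (⁻¹-anti-homo‿- x y))
                      (trans (sym (assoc x y (- x))) (xyx⁻¹≈y x y)))

    -- The valuation on the quotient.

    open QuotientOrder H-isSubgroup H-initial H-coset-~ public

    ∉H-ultrametric : ∀ {x y} → ¬ H x → ¬ H y → ¬ H (x + y) → y ≲ x → (x + y) ≲ x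
    ∉H-ultrametric {x} {y} x∉H y∉H w∉H y≲x with em-r {(x + y) ≲ x}
    ... | yes w≲x = w≲x
    -- Both uses of `Q₂` rest on `w≴x`: it excludes `x ~ w`, and also `- w ~ x` because `w ~ - w`.
    ... | no  w≴x = ≲-trans w≲w+x (≲-trans w+x≲-y (≲-trans (proj₂ (∉H⇒~neg y∉H)) y≲x))
      where
      w = x + y

      w~-w : w ~ - w
      w~-w = ∉H⇒~neg w∉H

      -w+x≈-y : - w + x ≈ - y
      -w+x≈-y = inverseˡ-unique (- w + x) y (trans (assoc (- w) x y) (inverseˡ w))

      w≲w+x : w ≲ (w + x)
      w≲w+x = shift w (identityˡ w) (comm x w) (∉H⇒0≲ x∉H) (w≴x ∘ proj₂)

      w+x≲-y : (w + x) ≲ (- y)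
      w+x≲-y = shift x refl -w+x≈-y (proj₁ w~-w) (w≴x ∘ ≲-trans (proj₁ w~-w) ∘ proj₁)

    ≲/-ultrametric : ∀ {x y} → y ≲/ x → (x + y) ≲/ x
    ≲/-ultrametric {x} {y} y≲/x with em {H x} | em {H y} | em {H (x + y)}
    ... | _       | _       | yes w∈H = mem⇒≲/ w∈H
    ... | yes x∈H | _       | no  w∉H = contradiction (H-+ x∈H (≲/-mem y≲/x x∈H)) w∉H
    ... | no  x∉H | yes y∈H | no  _   = ≲⇒≲/ (proj₁ (H-absorbed x∉H y∈H))
    ... | no  x∉H | no  y∉H | no  w∉H =
      ≲⇒≲/ (∉H-ultrametric x∉H y∉H w∉H (≲/⇒≲ x∉H y≲/x))

    ≲/-neg : ∀ x → (- x) ≲/ x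
    ≲/-neg x with em {H x}
    ... | yes x∈H = mem⇒≲/ (H-neg x∈H)
    ... | no  x∉H = ≲⇒≲/ (proj₂ (∉H⇒~neg x∉H))

    ≲/-induced : IsInducedByValuation (c ⊔ ℓ ⊔ r) (quotient G H-isSubgroup) _≲/_
    ≲/-induced = ultrametric⇒induced (quotient G H-isSubgroup) _≲/_ ≲/-isTotalPreorder
      (λ _ → em) (λ x≲/0 → mem⇒≈/ (≲/-mem x≲/0 H-0) H-0) ≲/-neg ≲/-ultrametric

  -- From the subgroup back to compatibility.

  module ToCompatible {H : Pred Carrier (c ⊔ ℓ ⊔ r)} (isSubgroup : IsSubgroup G H)
           (initial : IsInitialSegment _≲_ H)
           (ordered : IsOrderedAbelianGroup (subgroup G isSubgroup) (restrict H _≲_))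
           (induced : IsInducedByValuation b (quotient G isSubgroup) (QuotientRel G H _≲_))
           (coset-~ : ∀ g h → ¬ H g → H (g - h) → Sim _≲_ g h)
           where

    open IsSubgroup isSubgroup
    open IsOrderedAbelianGroup ordered
    open QuotientOrder isSubgroup initial coset-~

    private
      ≲/-neg : ∀ x → (- x) ≲/ x
      ≲/-neg = induced-neg (quotient G isSubgroup) _≲/_ induced

      ≲/-+ : ∀ {x y z} → x ≲/ z → y ≲/ z → (x + y) ≲/ z
      ≲/-+ = induced-+ (quotient G isSubgroup) _≲/_ induced

    -- `x` equals `(x + y) - y`, and the elements `≲/`-below `z` are closed under sums and negation.
    ≲/-+-cancel : ∀ {x y z} → (x + y) ≲/ z → y ≲/ z → x ≲/ z
    ≲/-+-cancel {x} {y} x+y≲/z y≲/z = ≲/-trans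
      (≲⇒≲/ (≲-reflexive (sym (//-rightDividesʳ y x))))
      (≲/-+ x+y≲/z (≲/-trans (≲/-neg y) y≲/z))

    -- One half of `v (x + y) = min (v x) (v y)` for distinct values: if the sum fell below `y`, so
    -- would `x = (x + y) - y`.
    ≲/-dominant : ∀ {x y} → ¬ (x ≲/ y) → x ≲/ (x + y)
    ≲/-dominant {x} {y} x≴/y with total y (x + y)
    ... | inj₁ y≲x+y = ≲/-+-cancel (≲⇒≲/ ≲-refl) (≲⇒≲/ y≲x+y)
    ... | inj₂ x+y≲y = contradiction (≲/-+-cancel (≲⇒≲/ x+y≲y) (≲⇒≲/ ≲-refl)) x≴/y

    H-absorbed : ∀ {x s} → ¬ H x → H s → x ~ (s + x)
    H-absorbed {x} {s} x∉H s∈H = coset-~ x (s + x) x∉H (resp -s≈ (neg-closed s∈H))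
      where
      -s≈ : - s ≈ x - (s + x)
      -s≈ = trans (sym (//-rightDividesʳ x (- s)))
              (trans (∙-congʳ (comm (- s) x))
                (trans (assoc x (- s) (- x)) (∙-congˡ (⁻¹-∙-comm s x))))

    +-mono : ∀ x y z → x ≲ y → ¬ (y ~ z) → (x + z) ≲ (y + z)
    +-mono x y z x≲y y≁z with em {H y}
    +-mono x y z x≲y y≁z | yes y∈H with em {H z}
    ... | yes z∈H = +-monoˡ-≤ (x , initial y∈H x≲y) (y , y∈H) (z , z∈H) x≲y
    ... | no  z∉H = ≲-trans (proj₂ (H-absorbed z∉H (initial y∈H x≲y))) (proj₁ (H-absorbed z∉H y∈H))
    +-mono x y z x≲y y≁z | no y∉H with em {y ≲/ z}
    -- Here `y` dominates `z`, so `x + z ≲/ y ≲/ y + z`. The last relation also keeps `y + z`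
    -- outside `H`, which allows the return to `≲`.
    ... | no y≴/z = ≲/⇒≲ (y∉H ∘ ≲/-mem y≲/y+z)
            (≲/-trans (≲/-+ (≲⇒≲/ x≲y) z≲/y) y≲/y+z)
      where
      y≲/y+z = ≲/-dominant y≴/z

      z≲/y : z ≲/ y
      z≲/y = ≲⇒≲/ (≴⇒≲ (y≴/z ∘ ≲⇒≲/))
    -- Now `z` dominates `y` strictly, since `z ≲/ y` would give `y ~ z` outside `H`; hence
    -- `x + z ≲/ z ≲/ y + z`.
    ... | yes y≲/z = ≲/⇒≲ (z∉H ∘ ≲/-mem z≲/y+z)
            (≲/-trans (≲/-+ (≲/-trans (≲⇒≲/ x≲y) y≲/z) (≲⇒≲/ ≲-refl)) z≲/y+z)
      where
      z∉H : ¬ H z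
      z∉H = y∉H ∘ ≲/-mem y≲/z

      z≲/y+z : z ≲/ (y + z)
      z≲/y+z = ≲/-trans
        (≲/-dominant λ z≲/y → y≁z (≲/⇒≲ z∉H y≲/z , ≲/⇒≲ y∉H z≲/y))
        (≲⇒≲/ (≲-reflexive (comm z y)))

    isCompatible : IsCompatible G _≲_
    isCompatible = record
      -- `x ≲ 0#` puts `x` into the initial segment `H`, where the order is antisymmetric.
      { Q₁ = λ x (x≲0 , 0≲x) → IsTotalOrder.antisym isTotalOrder {x , initial 0-mem x≲0} {0# , 0-mem} x≲0 0≲x
      ; Q₂ = +-mono
      }

mainTheorem2 : ∀ {c ℓ r : Level} → ExcludedMiddle (c ⊔ ℓ ⊔ r) →
    (G : AbelianGroup c ℓ) → let open AbelianGroup G in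
    (_≲_ : Rel Carrier r) → IsTotalPreorder _≈_ _≲_ →
    IsCompatible G _≲_ ⇔
    (Σ[ H ∈ Pred Carrier (c ⊔ ℓ ⊔ r) ] Σ[ isSubgroup ∈ IsSubgroup G H ]
      let G/H = quotient G isSubgroup
          _≈/_ = AbelianGroup._≈_ G/H
          _≲/_ = QuotientRel G H _≲_
      in
        IsInitialSegment _≲_ H
      × IsOrderedAbelianGroup (subgroup G isSubgroup) (restrict H _≲_)
      × (_≲/_ Respects₂ _≈/_ × IsPreorder _≈/_ _≲/_ × IsInducedByValuation (c ⊔ ℓ ⊔ r) G/H _≲/_)
      × (∀ g h → ¬ H g → H (g - h) → Sim _≲_ g h))
mainTheorem2 em G _≲_ isTotalPreorder = mk⇔
  (λ isCompatible → let open FromCompatible G _≲_ isTotalPreorder em isCompatible in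
    H , H-isSubgroup , (λ {_} {_} → H-initial) , H-isOrderedAbelianGroup ,
    ( IsTotalPreorder.≲-resp-≈ ≲/-isTotalPreorder
    , IsTotalPreorder.isPreorder ≲/-isTotalPreorder
    , ≲/-induced) ,
    H-coset-~)
  (λ (H , isSubgroup , initial , ordered , (_ , _ , induced) , coset-~) →
    ToCompatible.isCompatible G _≲_ isTotalPreorder em isSubgroup initial ordered induced coset-~)
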